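{- Let $\sigma$ be a configuration, let $\tau\cdot\rho^\omega$ be a lasso applicable to $\sigma$, and let $\varphi$ be an $\mathsf{ELTL}_{\mathsf{FT}}$ formula. If there is a witness of $\mathsf{path}(\sigma,\tau\cdot\rho^\omega)\models\varphi$, then the lasso $\tau\cdot\rho^\omega$ satisfies $\varphi$, that is, $\mathsf{path}(\sigma,\tau\cdot\rho^\omega)\models\varphi$.
   Context: **Threshold automata.** A threshold automaton is a tuple $\mathsf{TA}=(\mathcal L,\mathcal I,\Gamma,\Pi,\mathcal R,RC)$: $\mathcal L=\{1,\dots,|\mathcal L|\}$ is a finite set of local states, $\mathcal I\subseteq\mathcal L$ the initial local states; $\Gamma$ and $\Pi$ are finite sets of shared variables and parameters, ranging over $\mathbb N_0$; $RC$ is a linear integer arithmetic formula over $\Pi$, and $\mathbf P_{RC}=\{\mathbf p\in\mathbb N_0^{|\Pi|}:\mathbf p\models RC\}$ is the set of admissible parameter values; $\mathcal R$ is a finite set of rules. A rule is $r=(\mathit{from},\mathit{to},\varphi^{\le},\varphi^{>},\mathbf u)$ with $\mathit{from},\mathit{to}\in\mathcal L$, $\mathbf u\in\mathbb N_0^{|\Gamma|}$, $\varphi^{\le}$ a conjunction of lower guards $x\ge a_0+\sum_{i=1}^{|\Pi|}a_ip_i$, and $\varphi^{>}$ a conjunction of upper guards $x<a_0+\sum_{i=1}^{|\Pi|}a_ip_i$ ($x\in\Gamma$, $a_i\in\mathbb Z$, $p_i\in\Pi$). $\Phi^{\mathrm{rise}}$, $\Phi^{\mathrm{fall}}$ are the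 sets of lower and upper guards. Standing assumptions: a rule lying on a cycle (of the directed graph on $\mathcal L$ with edges $\mathit{from}\to\mathit{to}$) has $\mathbf u=\mathbf 0$; all cycles are simple, i.e. between any two locations in a cycle there is exactly one node-disjoint directed path (nodes in cycles may have self-loops). A threshold automaton is fixed. **Counter systems.** Fix a function $N:\mathbf P_{RC}\to\mathbb N_0$ (a linear combination of parameters) and $\mathbf p\in\mathbf P_{RC}$. A configuration is $\sigma=(\boldsymbol\kappa,\mathbf g,\mathbf p)$ with counters $\sigma.\boldsymbol\kappa\in\mathbb N_0^{|\mathcal L|}$, shared variable values $\sigma.\mathbf g\in\mathbb N_0^{|\Gamma|}$ and parameter values $\sigma.\mathbf p=\mathbf p$. A transition is $t=(\mathit{rule},\mathit{factor})$ with $\mathit{rule}\in\mathcal R$, $\mathit{factor}\in\mathbb N_0$; write $t.\mathit{from}=t.\mathit{rule}.\mathit{from}$, etc. $t$ is unlocked in $\sigma$ if for all $k\in\{0,\dots,t.\mathit{factor}-1\}$, $(\sigma.\boldsymbol\kappa,\sigma.\mathbf g+k\cdot t.\mathbf u,\sigma.\mathbf p)\models t.\varphi^{\le}\wedge t.\varphi^{>}$; it is applicable (enabled) in $\sigma$ if it is unlocked and $\sigma.\boldsymbol\kappa[t.\mathit{from}]\ge t.\mathit{factor}$, or $t.\mathit{factor}=0$. Then $\sigma'=t(\sigma)$ is given by $\sigma'.\mathbf g=\sigma.\mathbf g+t.\mathit{factor}\cdot t.\mathbf u$, $\sigma'.\mathbf p=\sigma.\mathbf p$, and $\sigma'.\boldsymbol\kappa$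 is obtained from $\sigma.\boldsymbol\kappa$ by subtracting $t.\mathit{factor}$ at $t.\mathit{from}$ and adding it at $t.\mathit{to}$ (no change if $t.\mathit{from}=t.\mathit{to}$). A schedule is a finite or infinite sequence $t_1,t_2,\dots$ of transitions; it is applicable to $\sigma_0$ if there are $\sigma_i=t_i(\sigma_{i-1})$ with $t_i$ applicable in $\sigma_{i-1}$ for all $i$; $\mathsf{path}(\sigma_0,\tau)$ is the sequence $\sigma_0,t_1,\sigma_1,t_2,\dots$, and for finite $\tau$, $\tau(\sigma_0)$ is its last configuration. $|\tau|$ is the length, $\tau\cdot\tau'$ concatenation. $\mathsf{Cfgs}(\sigma,\tau)\models\psi$ means $\tau'(\sigma)\models\psi$ for every prefix $\tau'$ of the finite schedule $\tau$ (including the empty prefix and $\tau$). A lasso (schedule) applicable to $\sigma$ is an infinite schedule $\tau\cdot\rho^\omega$ applicable to $\sigma$ with finite $\tau,\rho$ and $\rho^k(\tau(\sigma))=\tau(\sigma)$ for all $k\ge0$. An index $k$ cuts a schedule $\pi$ into $\pi',\pi''$ if $\pi=\pi'\cdot\pi''$ and $|\pi'|=k$. **$\mathsf{ELTL}_{\mathsf{FT}}$.** Syntax: $\psi::=\mathit{pform}\mid \mathbf G\psi\mid\mathbf F\psi\mid\psi\wedge\psi$; $\mathit{pform}::=\mathit{cform}\mid\mathit{gform}\vee\mathit{cform}$; $\mathit{cform}::=\bigvee_{\ell\in\mathit{Locs}}\boldsymbol\kappa[\ell]\ne0\mid\bigwedge_{\ell\in\mathit{Locs}}\boldsymbol\kappa[\ell]=0\mid\mathit{cform}\wedge\mathit{cform}$;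 $\mathit{gform}::=\mathit{guard}\mid\neg\mathit{gform}\mid\mathit{gform}\wedge\mathit{gform}$, with $\mathit{Locs}\subseteq\mathcal L$ and $\mathit{guard}\in\Phi^{\mathrm{rise}}\cup\Phi^{\mathrm{fall}}$. For infinite $\tau$ applicable to $\sigma$: $\mathsf{path}(\sigma,\tau)\models\varphi$ for propositional $\varphi$ iff $\sigma\models\varphi$; $\mathbf F\psi$ (resp. $\mathbf G\psi$) holds iff for some (resp. every) decomposition $\tau=\tau'\cdot\tau''$ with $\tau'$ finite, $\mathsf{path}(\tau'(\sigma),\tau'')\models\psi$; conjunction is standard. $\mathit{true}$ is a valid propositional formula, e.g. the empty conjunction. **Canonical formulas.** Propositional formulas are (finite conjunctions of) formulas derived from $\mathit{pform}$. Inductively: $p\wedge\mathbf G\,\mathit{true}$ ($p$ propositional) is canonical of rank 0; $p\wedge\mathbf F\psi_1\wedge\dots\wedge\mathbf F\psi_k\wedge\mathbf G\,\mathit{true}$ with $k\ge1$, $\psi_i$ canonical of any rank, is canonical of rank 1; $p\wedge\mathbf F\psi_1\wedge\dots\wedge\mathbf F\psi_k\wedge\mathbf G\psi_{k+1}$ with $k\ge0$, $\psi_1,\dots,\psi_k$ canonical of any rank and $\psi_{k+1}$ canonical of rank 0 or 1, is canonical of rank 2. Fix a function $\mathit{can}$ assigning to each formula an equivalent canonical formula. For $\psi$ with $\mathit{can}(\psi)=\psi_0\wedge\mathbf F\psi_1\wedge\dots\wedge\mathbf F\psi_k\wedge\mathbf G\psi_{k+1}$, $\mathit{prop}(\psi)=\psi_0$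 (and $\mathit{prop}(\mathit{true})=\mathit{true}$). **Canonical syntax tree.** $\mathcal T(\varphi)\subseteq\mathsf{ELTL}_{\mathsf{FT}}\times\mathbb N_0^*$ contains the root $\langle\mathit{can}(\varphi),0\rangle$; and whenever $\langle\psi,w\rangle\in\mathcal T(\varphi)$ where $\psi=\psi'=\mathit{can}(\varphi)$, or $\psi=\mathbf F\psi'$, or $\psi=\mathbf G\psi'$, with $\psi'=p\wedge\mathbf F\psi_1\wedge\dots\wedge\mathbf F\psi_k\wedge\mathbf G\psi_{k+1}$ canonical, it contains $\langle p,w.0\rangle$, $\langle\mathbf F\psi_i,w.i\rangle$ ($1\le i\le k$) and $\langle\mathbf G\psi_{k+1},w.(k+1)\rangle$. A node with id $w$ is covered by a $\mathbf G$-node if $w=u_1.u_2$ with $\langle\mathbf G\psi,u_1\rangle\in\mathcal T(\varphi)$ for some $\psi$. **Cut graphs.** A cut graph of $\varphi$ is a directed acyclic graph $(\mathcal V,\mathcal E)$ with $\mathcal V=\{\mathsf{loop}_{\mathsf{start}},\mathsf{loop}_{\mathsf{end}}\}\cup\{w:\exists\psi.\ \langle\mathbf F\psi,w\rangle\in\mathcal T(\varphi)\}$ and edges satisfying: (a) for each $\langle\mathbf F\psi,w\rangle\in\mathcal T(\varphi)$ not covered by a $\mathbf G$-node, $(w,\mathsf{loop}_{\mathsf{start}})\in\mathcal E$; (b) for each $\langle\mathbf F\psi,w\rangle$ covered by a $\mathbf G$-node, $(\mathsf{loop}_{\mathsf{start}},w),(w,\mathsf{loop}_{\mathsf{end}})\in\mathcal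 E$; (c) for each pair $\langle\mathbf F\psi_1,w\rangle,\langle\mathbf F\psi_2,w.i\rangle$ not covered by a $\mathbf G$-node, $(w,w.i)\in\mathcal E$; (d) for each pair of distinct nodes $\langle\mathbf F\psi_1,w_1\rangle,\langle\mathbf F\psi_2,w_2\rangle$ both covered by a $\mathbf G$-node, exactly one of $(w_1,w_2),(w_2,w_1)$ is in $\mathcal E$. Given a lasso $\tau\cdot\rho^\omega$, a cut function is $\zeta:\mathcal V\to\{0,\dots,|\tau|+|\rho|-1\}$ with $\zeta(\mathsf{loop}_{\mathsf{start}})=|\tau|$, $\zeta(\mathsf{loop}_{\mathsf{end}})=|\tau|+|\rho|-1$, and $\zeta(v)\le\zeta(v')$ for every $(v,v')\in\mathcal E$. **Witness.** A cut function $\zeta$ (of a cut graph of $\varphi$, for the lasso $\tau\cdot\rho^\omega$) is a witness of $\mathsf{path}(\sigma,\tau\cdot\rho^\omega)\models\varphi$ if: (C1) for $\mathit{can}(\varphi)=\psi_0\wedge\mathbf F\psi_1\wedge\dots\wedge\mathbf F\psi_k\wedge\mathbf G\psi_{k+1}$: $\sigma\models\psi_0$ and $\mathsf{Cfgs}(\sigma,\tau\cdot\rho)\models\mathit{prop}(\psi_{k+1})$; (C2) for each $\langle\mathbf F\psi,v\rangle\in\mathcal T(\varphi)$ with $\zeta(v)<|\tau|$, if $\zeta(v)$ cuts $\tau\cdot\rho$ into $\pi',\pi''$ and $\psi=\psi_0\wedge\mathbf F\psi_1\wedge\dots\wedge\mathbf F\psi_k\wedge\mathbf G\psi_{k+1}$,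 then $\pi'(\sigma)\models\psi_0$ and $\mathsf{Cfgs}(\pi'(\sigma),\pi'')\models\mathit{prop}(\psi_{k+1})$; (C3) for each $\langle\mathbf F\psi,v\rangle\in\mathcal T(\varphi)$ with $\zeta(v)\ge|\tau|$, with the same notation, $\pi'(\sigma)\models\psi_0$ and $\mathsf{Cfgs}(\tau(\sigma),\rho)\models\mathit{prop}(\psi_{k+1})$.
   Formalization: prop(ψ) is read off the canonical formula ψ itself (as if can(ψ)=ψ for canonical ψ) rather than through an arbitrary equivalent can(ψ); with a can that rewrites canonical formulas the claim fails, e.g. can((x<3)∧G true) = true∧F((x<3)∧G true)∧G true. -}

module Defs where

open import Data.Bool using (if_then_else_)
open import Data.Empty using (⊥)
open import Data.Fin using (Fin; toℕ; _≟_)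
import Data.Fin.Subset as Subset
open import Data.Fin.Subset using (Subset)
open import Data.Integer as ℤ using (ℤ; 0ℤ)
open import Data.List using (List; []; _∷_; [_]; _++_; _∷ʳ_; length; lookup; head; last; concat; replicate; applyUpTo; foldr; foldl)
open import Data.List.Membership.Propositional using (_∈_)
open import Data.List.Relation.Unary.All using (All)
open import Data.List.Relation.Unary.Linked using (Linked)
open import Data.List.Relation.Unary.Unique.Propositional using (Unique)
open import Data.Maybe using (just)
open import Data.Nat using (ℕ; zero; suc; _+_; _*_; _∸_; _≤_; _<_; NonZero)
open import Data.Nat.DivMod using (_mod_)
open import Data.Product using (Σ; ∃; ∃-syntax; ∃!; _×_; _,_)
open import Data.Sum using (_⊎_)
open import Data.Vec as Vec using (Vec)
open import Function.Bundles using (_⇔_)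
open import Relation.Binary.Construct.Closure.ReflexiveTransitive using (Star)
open import Relation.Binary.Construct.Closure.Transitive using (TransClosure)
open import Relation.Binary.PropositionalEquality using (_≡_)
open import Relation.Nullary using (¬_; does)

_·_ : ∀ {n} → Vec ℤ n → Vec ℤ n → ℤ
a · v = Vec.foldr′ ℤ._+_ 0ℤ (Vec.zipWith ℤ._*_ a v)

record LinExpr (n : ℕ) : Set where
  constructor _+Σ_
  field
    const  : ℤ
    coeffs : Vec ℤ n

⟦_⟧ : ∀ {n} → LinExpr n → Vec ℤ n → ℤ
⟦ a₀ +Σ a ⟧ v = a₀ ℤ.+ (a · v)

-- Quantifiers range over ℤ; they bind the first coordinate of the
-- environment.
data LIA : ℕ → Set where
  _≤ᴸ_ _≡ᴸ_ : ∀ {n} → LinExpr n → LinExpr n → LIA n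
  ¬ᴸ_       : ∀ {n} → LIA n → LIA n
  _∧ᴸ_ _∨ᴸ_ : ∀ {n} → LIA n → LIA n → LIA n
  ∃ᴸ_ ∀ᴸ_   : ∀ {n} → LIA (suc n) → LIA n

_⊨ᴸ_ : ∀ {n} → Vec ℤ n → LIA n → Set
v ⊨ᴸ (e ≤ᴸ e′) = ⟦ e ⟧ v ℤ.≤ ⟦ e′ ⟧ v
v ⊨ᴸ (e ≡ᴸ e′) = ⟦ e ⟧ v ≡ ⟦ e′ ⟧ v
v ⊨ᴸ (¬ᴸ F)    = ¬ (v ⊨ᴸ F)
v ⊨ᴸ (F ∧ᴸ H)  = (v ⊨ᴸ F) × (v ⊨ᴸ H)
v ⊨ᴸ (F ∨ᴸ H)  = (v ⊨ᴸ F) ⊎ (v ⊨ᴸ H)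
v ⊨ᴸ (∃ᴸ F)    = ∃[ z ] ((z Vec.∷ v) ⊨ᴸ F)
v ⊨ᴸ (∀ᴸ F)    = ∀ z → (z Vec.∷ v) ⊨ᴸ F

module _ (|Γ| |Π| : ℕ) where

  data LowerGuard : Set where
    _≥ᵍ_ : Fin |Γ| → LinExpr |Π| → LowerGuard

  data UpperGuard : Set where
    _<ᵍ_ : Fin |Γ| → LinExpr |Π| → UpperGuard

-- The lists φ≤ and φ> are read conjunctively.
record Rule (|𝓛| |Γ| |Π| : ℕ) : Set where
  field
    from to : Fin |𝓛|
    φ≤      : List (LowerGuard |Γ| |Π|)
    φ>      : List (UpperGuard |Γ| |Π|)
    u       : Vec ℕ |Γ|

record SimplePath {n} (Edge : Fin n → Fin n → Set) (ℓ ℓ′ : Fin n)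
                  (nodes : List (Fin n)) : Set where
  field
    starts   : head nodes ≡ just ℓ
    ends     : last nodes ≡ just ℓ′
    linked   : Linked Edge nodes
    distinct : Unique nodes

record ThresholdAutomaton : Set where
  field
    |𝓛| |Γ| |Π| : ℕ
    initial     : Subset |𝓛|
    RC          : LIA |Π|
    rules       : List (Rule |𝓛| |Γ| |Π|)

  Edge : Fin |𝓛| → Fin |𝓛| → Set
  Edge ℓ ℓ′ = ∃[ r ] (r ∈ rules × Rule.from r ≡ ℓ × Rule.to r ≡ ℓ′)

  -- ℓ and ℓ′ lie on a common cycle iff each is reachable from the other.
  -- Self-loops never occur in a simple path, so they are unrestricted.
  field
    cycles-no-update : ∀ r → r ∈ rules → Star Edge (Rule.to r) (Rule.from r) →
                       Rule.u r ≡ Vec.replicate |Γ| 0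
    cycles-simple    : ∀ ℓ ℓ′ → Star Edge ℓ ℓ′ → Star Edge ℓ′ ℓ →
                       ∃! _≡_ (SimplePath Edge ℓ ℓ′)

  Admissible : Vec ℕ |Π| → Set
  Admissible p = Vec.map ℤ.+_ p ⊨ᴸ RC

record CounterSystem (TA : ThresholdAutomaton) : Set where
  open ThresholdAutomaton TA
  field
    N          : (p : Vec ℕ |Π|) → Admissible p → ℕ
    N-linear   : ∃[ c ] (∀ p (a : Admissible p) → ℤ.+ N p a ≡ c · Vec.map ℤ.+_ p)
    𝐩          : Vec ℕ |Π|
    admissible : Admissible 𝐩

module Syntax (TA : ThresholdAutomaton) where
  open ThresholdAutomaton TA

  data CForm : Set where
    ⋁κ≠0 ⋀κ=0 : Subset |𝓛| → CForm
    _∧ᶜ_      : CForm → CForm → CForm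

  data GForm : Set where
    rise : LowerGuard |Γ| |Π| → GForm
    fall : UpperGuard |Γ| |Π| → GForm
    ¬ᵍ_  : GForm → GForm
    _∧ᵍ_ : GForm → GForm → GForm

  data PForm : Set where
    cform : CForm → PForm
    _∨ᵖ_  : GForm → CForm → PForm

  infixr 6 _∧_
  infix  7 𝐆_ 𝐅_

  data Formula : Set where
    pform : PForm → Formula
    𝐆_ 𝐅_ : Formula → Formula
    _∧_   : Formula → Formula → Formula

  true : Formula
  true = pform (cform (⋀κ=0 Subset.⊥))

  data Propositional : Formula → Set where
    pform : ∀ π → Propositional (pform π)
    _∧_   : ∀ {p q} → Propositional p → Propositional q → Propositional (p ∧ q)

  -- p ∧𝐅 (ψ₁ ∷ … ∷ ψₖ ∷ []) ∧𝐆 χ  is  p ∧ 𝐅 ψ₁ ∧ … ∧ 𝐅 ψₖ ∧ 𝐆 χ.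
  _∧𝐅_∧𝐆_ : Formula → List Formula → Formula → Formula
  p ∧𝐅 ψs ∧𝐆 χ = p ∧ foldr (λ ψ φ → 𝐅 ψ ∧ φ) (𝐆 χ) ψs

  data Canonical : ℕ → Formula → Set where
    rank₀ : ∀ {p} → Propositional p → Canonical 0 (p ∧𝐅 [] ∧𝐆 true)
    rank₁ : ∀ {p ψ ψs} → Propositional p →
            All (λ ψ′ → ∃[ r ] Canonical r ψ′) (ψ ∷ ψs) →
            Canonical 1 (p ∧𝐅 (ψ ∷ ψs) ∧𝐆 true)
    rank₂ : ∀ {p ψs χ r} → Propositional p →
            All (λ ψ′ → ∃[ r′ ] Canonical r′ ψ′) ψs →
            r ≤ 1 → Canonical r χ →
            Canonical 2 (p ∧𝐅 ψs ∧𝐆 χ)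

  IsCanonical : Formula → Set
  IsCanonical ψ = ∃[ r ] Canonical r ψ

  -- Only used for the χ of a canonical p ∧𝐅 ψs ∧𝐆 χ.  Such a χ is either
  -- itself canonical, hence its own canonical form, so that the first clause
  -- returns its propositional conjunct; or it is true, which is returned
  -- unchanged.
  prop : Formula → Formula
  prop (ψ₀ ∧ _) = ψ₀
  prop ψ        = ψ

module Semantics (TA : ThresholdAutomaton) (S : CounterSystem TA) where
  open ThresholdAutomaton TA
  open CounterSystem S using (𝐩)
  open Syntax TA public

  -- The parameter component p of a configuration is the fixed 𝐩.
  record Config : Set where
    constructor ⟨_,_⟩
    field
      κ : Vec ℕ |𝓛|
      g : Vec ℕ |Γ|
    p : Vec ℕ |Π|
    p = 𝐩

  record Transition : Set where
    field
      rule   : Rule |𝓛| |Γ| |Π|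
      rule∈  : rule ∈ rules
      factor : ℕ
    open Rule rule public

  threshold : Config → LinExpr |Π| → ℤ
  threshold σ e = ⟦ e ⟧ (Vec.map ℤ.+_ (Config.p σ))

  _⊨≥_ : Config → LowerGuard |Γ| |Π| → Set
  σ ⊨≥ (x ≥ᵍ e) = ℤ.+ Vec.lookup (Config.g σ) x ℤ.≥ threshold σ e

  _⊨<_ : Config → UpperGuard |Γ| |Π| → Set
  σ ⊨< (x <ᵍ e) = ℤ.+ Vec.lookup (Config.g σ) x ℤ.< threshold σ e

  _+ⱽ_·_ : ∀ {n} → Vec ℕ n → ℕ → Vec ℕ n → Vec ℕ n
  g +ⱽ k · u = Vec.zipWith _+_ g (Vec.map (k *_) u)

  module _ (t : Transition) (σ : Config) where
    open Transition t
    open Config σ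

    Unlocked : Set
    Unlocked = ∀ k → k < factor →
      All (⟨ κ , g +ⱽ k · u ⟩ ⊨≥_) φ≤ × All (⟨ κ , g +ⱽ k · u ⟩ ⊨<_) φ>

    Applicable : Set
    Applicable = (Unlocked × factor ≤ Vec.lookup κ from) ⊎ factor ≡ 0

    -- Truncated subtraction is exact whenever t is applicable.
    apply : Config
    apply = ⟨ (if does (from ≟ to) then κ else
                 Vec.updateAt (Vec.updateAt κ from (_∸ factor)) to (_+ factor))
            , g +ⱽ factor · u ⟩

  Schedule Schedule∞ : Set
  Schedule  = List Transition
  Schedule∞ = ℕ → Transition

  execute : Schedule → Config → Config
  execute τ σ = foldl (λ σ′ t → apply t σ′) σ τ

  prefix : ℕ → Schedule∞ → Schedule
  prefix k τ = applyUpTo τ k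

  suffix : ℕ → Schedule∞ → Schedule∞
  suffix k τ i = τ (k + i)

  Applicable∞ : Schedule∞ → Config → Set
  Applicable∞ τ σ = ∀ i → Applicable (τ i) (execute (prefix i τ) σ)

  infixr 5 _++∞_

  _++∞_ : Schedule → Schedule∞ → Schedule∞
  ([] ++∞ π) i            = π i
  ((t ∷ τ) ++∞ π) zero    = t
  ((t ∷ τ) ++∞ π) (suc i) = (τ ++∞ π) i

  _^ω : (ρ : Schedule) .{{_ : NonZero (length ρ)}} → Schedule∞
  (ρ ^ω) i = lookup ρ (i mod length ρ)

  record Lasso (σ : Config) : Set where
    field
      τ ρ              : Schedule
      .{{ρ-nonempty}}  : NonZero (length ρ)

    schedule : Schedule∞
    schedule = τ ++∞ (ρ ^ω)

    field
      applicable : Applicable∞ schedule σ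
      returns    : ∀ k → execute (concat (replicate k ρ)) (execute τ σ) ≡ execute τ σ

  _⊨ᶜ_ : Config → CForm → Set
  σ ⊨ᶜ ⋁κ≠0 Locs = ∃[ ℓ ] (ℓ Subset.∈ Locs × ¬ (Vec.lookup (Config.κ σ) ℓ ≡ 0))
  σ ⊨ᶜ ⋀κ=0 Locs = ∀ ℓ → ℓ Subset.∈ Locs → Vec.lookup (Config.κ σ) ℓ ≡ 0
  σ ⊨ᶜ (c ∧ᶜ d)  = (σ ⊨ᶜ c) × (σ ⊨ᶜ d)

  _⊨ᵍ_ : Config → GForm → Set
  σ ⊨ᵍ rise γ   = σ ⊨≥ γ
  σ ⊨ᵍ fall γ   = σ ⊨< γ
  σ ⊨ᵍ (¬ᵍ γ)   = ¬ (σ ⊨ᵍ γ)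
  σ ⊨ᵍ (γ ∧ᵍ δ) = (σ ⊨ᵍ γ) × (σ ⊨ᵍ δ)

  _⊨ᵖ_ : Config → PForm → Set
  σ ⊨ᵖ cform c  = σ ⊨ᶜ c
  σ ⊨ᵖ (γ ∨ᵖ c) = (σ ⊨ᵍ γ) ⊎ (σ ⊨ᶜ c)

  -- A single configuration satisfies propositional formulas only.
  _⊨_ : Config → Formula → Set
  σ ⊨ pform π = σ ⊨ᵖ π
  σ ⊨ (𝐆 _)   = ⊥
  σ ⊨ (𝐅 _)   = ⊥
  σ ⊨ (φ ∧ ψ) = (σ ⊨ φ) × (σ ⊨ ψ)

  -- A decomposition of τ into a finite prefix and the remaining infinite
  -- schedule is determined by the length k of the prefix.
  path⟨_,_⟩⊨_ : Config → Schedule∞ → Formula → Set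
  path⟨ σ , τ ⟩⊨ pform π = σ ⊨ pform π
  path⟨ σ , τ ⟩⊨ (𝐆 ψ)   = ∀ k → path⟨ execute (prefix k τ) σ , suffix k τ ⟩⊨ ψ
  path⟨ σ , τ ⟩⊨ (𝐅 ψ)   = ∃[ k ] path⟨ execute (prefix k τ) σ , suffix k τ ⟩⊨ ψ
  path⟨ σ , τ ⟩⊨ (φ ∧ ψ) = (path⟨ σ , τ ⟩⊨ φ) × (path⟨ σ , τ ⟩⊨ ψ)

  Cfgs⟨_,_⟩⊨_ : Config → Schedule → Formula → Set
  Cfgs⟨ σ , τ ⟩⊨ ψ = ∀ τ′ τ″ → τ ≡ τ′ ++ τ″ → execute τ′ σ ⊨ ψ

  Cuts : ℕ → Schedule → Schedule → Schedule → Set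
  Cuts k π π′ π″ = π ≡ π′ ++ π″ × length π′ ≡ k

  record CanonicalForms : Set where
    field
      can        : Formula → Formula
      canonical  : ∀ φ → IsCanonical (can φ)
      equivalent : ∀ φ σ τ → Applicable∞ τ σ →
                   (path⟨ σ , τ ⟩⊨ φ) ⇔ (path⟨ σ , τ ⟩⊨ can φ)

  Id : Set
  Id = List ℕ

  module _ (C : CanonicalForms) (φ : Formula) where
    open CanonicalForms C

    data Body : Formula → Formula → Set where
      whole  : Body (can φ) (can φ)
      under𝐅 : ∀ {ψ′} → Body (𝐅 ψ′) ψ′
      under𝐆 : ∀ {ψ′} → Body (𝐆 ψ′) ψ′

    -- 𝓣 ψ w means ⟨ψ , w⟩ ∈ 𝓣(φ).
    data 𝓣 : Formula → Id → Set where
      root   : 𝓣 (can φ) [ 0 ]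
      child₀ : ∀ {ψ w p ψs χ} → 𝓣 ψ w →
               Body ψ (p ∧𝐅 ψs ∧𝐆 χ) → IsCanonical (p ∧𝐅 ψs ∧𝐆 χ) →
               𝓣 p (w ∷ʳ 0)
      child𝐅 : ∀ {ψ w p ψs χ} → 𝓣 ψ w →
               Body ψ (p ∧𝐅 ψs ∧𝐆 χ) → IsCanonical (p ∧𝐅 ψs ∧𝐆 χ) →
               ∀ i → 𝓣 (𝐅 (lookup ψs i)) (w ∷ʳ suc (toℕ i))
      child𝐆 : ∀ {ψ w p ψs χ} → 𝓣 ψ w →
               Body ψ (p ∧𝐅 ψs ∧𝐆 χ) → IsCanonical (p ∧𝐅 ψs ∧𝐆 χ) →
               𝓣 (𝐆 χ) (w ∷ʳ suc (length ψs))

    Covered : Id → Set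
    Covered w = ∃[ u₁ ] ∃[ u₂ ] ∃[ ψ ] (w ≡ u₁ ++ u₂ × 𝓣 (𝐆 ψ) u₁)

    -- The membership proof is irrelevant, so that vertices with the same id
    -- are equal.
    data Vertex : Set where
      loopStart loopEnd : Vertex
      node              : (w : Id) → .(∃[ ψ ] 𝓣 (𝐅 ψ) w) → Vertex

    vertex : ∀ {ψ w} → 𝓣 (𝐅 ψ) w → Vertex
    vertex {ψ} {w} n = node w (ψ , n)

    record CutGraph : Set₁ where
      field
        E       : Vertex → Vertex → Set
        acyclic : ∀ v → ¬ TransClosure E v v
        edges-a : ∀ {ψ w} (n : 𝓣 (𝐅 ψ) w) → ¬ Covered w →
                  E (vertex n) loopStart
        edges-b : ∀ {ψ w} (n : 𝓣 (𝐅 ψ) w) → Covered w →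
                  E loopStart (vertex n) × E (vertex n) loopEnd
        edges-c : ∀ {ψ₁ ψ₂ w i} (n₁ : 𝓣 (𝐅 ψ₁) w) (n₂ : 𝓣 (𝐅 ψ₂) (w ∷ʳ i)) →
                  ¬ Covered w → ¬ Covered (w ∷ʳ i) →
                  E (vertex n₁) (vertex n₂)
        edges-d : ∀ {ψ₁ ψ₂ w₁ w₂} (n₁ : 𝓣 (𝐅 ψ₁) w₁) (n₂ : 𝓣 (𝐅 ψ₂) w₂) →
                  ¬ (w₁ ≡ w₂) → Covered w₁ → Covered w₂ →
                  (E (vertex n₁) (vertex n₂) × ¬ E (vertex n₂) (vertex n₁)) ⊎
                  (E (vertex n₂) (vertex n₁) × ¬ E (vertex n₁) (vertex n₂))

    module _ {σ : Config} (L : Lasso σ) where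
      open Lasso L

      record CutFunction (𝒢 : CutGraph) : Set where
        open CutGraph 𝒢
        field
          ζ          : Vertex → Fin (length τ + length ρ)
          start      : toℕ (ζ loopStart) ≡ length τ
          end        : toℕ (ζ loopEnd) ≡ (length τ + length ρ) ∸ 1
          order      : ∀ {v v′} → E v v′ → toℕ (ζ v) ≤ toℕ (ζ v′)

      record IsWitness {𝒢 : CutGraph} (cut : CutFunction 𝒢) : Set where
        open CutFunction cut
        field
          C1 : ∀ {ψ₀ ψs χ} → can φ ≡ (ψ₀ ∧𝐅 ψs ∧𝐆 χ) →
               (σ ⊨ ψ₀) × (Cfgs⟨ σ , τ ++ ρ ⟩⊨ prop χ)
          C2 : ∀ {ψ₀ ψs χ v} (n : 𝓣 (𝐅 (ψ₀ ∧𝐅 ψs ∧𝐆 χ)) v) →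
               toℕ (ζ (vertex n)) < length τ →
               ∀ π′ π″ → Cuts (toℕ (ζ (vertex n))) (τ ++ ρ) π′ π″ →
               (execute π′ σ ⊨ ψ₀) × (Cfgs⟨ execute π′ σ , π″ ⟩⊨ prop χ)
          C3 : ∀ {ψ₀ ψs χ v} (n : 𝓣 (𝐅 (ψ₀ ∧𝐅 ψs ∧𝐆 χ)) v) →
               length τ ≤ toℕ (ζ (vertex n)) →
               ∀ π′ π″ → Cuts (toℕ (ζ (vertex n))) (τ ++ ρ) π′ π″ →
               (execute π′ σ ⊨ ψ₀) × (Cfgs⟨ execute τ σ , ρ ⟩⊨ prop χ)

      HasWitness : Set₁
      HasWitness = Σ CutGraph λ 𝒢 → Σ (CutFunction 𝒢) IsWitness

{-# OPTIONS --safe #-}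
-- From position |τ| on, the configurations of the lasso repeat with period |ρ|,
-- so a propositional formula that holds up to position |τ| + |ρ| holds forever.
-- An 𝐅-node covered by a 𝐆-node is cut inside the loop, hence its formula holds
-- at infinitely many positions, and so do those of its (covered) children.  An
-- uncovered 𝐅-node holds at its own cut position, because the cut graph places
-- its uncovered children no earlier.  The body of a 𝐆 in a canonical formula has
-- rank at most 1, so it only asks for an invariant and for covered 𝐅-nodes.
module Submission where

open import Defs
open import Data.Empty using (⊥-elim)
open import Data.Fin using (Fin; zero; suc; toℕ; fromℕ<)
open import Data.Fin.Properties using (toℕ<n; toℕ-fromℕ<; toℕ-injective; fromℕ<-cong)
import Data.Fin.Subset.Properties as Subset
open import Data.List using (List; []; _∷_; [_]; _++_; _∷ʳ_; length; lookup; take; drop; foldl; foldr;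
  initLast; _∷ʳ′_)
open import Data.List.Properties using (foldl-++; foldl-∷ʳ; ++-assoc; ++-identityʳ;
  length-++; length-take; take-all; take-[]; take++drop≡id; ∷ʳ-injectiveˡ)
open import Data.List.Relation.Unary.All using (All; []; _∷_)
open import Data.Nat using (ℕ; zero; suc; _+_; _*_; _⊓_; _≤_; z≤n; s≤s; NonZero)
open import Data.Nat.DivMod using (_%_; _/_; _mod_; m<n⇒m%n≡m; [m+n]%n≡m%n;
  m≡m%n+[m/n]*n; m%n≤n; m%n<n)
open import Data.Nat.Properties
open import Algebra.Properties.CommutativeSemigroup +-commutativeSemigroup using (x∙yz≈y∙xz)
open import Data.Product using (∃-syntax; _×_; _,_; proj₁; proj₂)
open import Data.Sum using (inj₁; inj₂)
open import Function using (_∘_; Equivalence)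
open import Relation.Binary.PropositionalEquality using (_≡_; _≢_; _≗_; refl; sym; trans;
  cong; cong₂; subst; module ≡-Reasoning)
open import Relation.Nullary using (¬_)

-- Splitting finite lists with `take` and `drop`.

take-+ : ∀ {A : Set} m n (xs : List A) → take (m + n) xs ≡ take m xs ++ take n (drop m xs)
take-+ zero    n xs       = refl
take-+ (suc m) n []       = sym (take-[] n)
take-+ (suc m) n (x ∷ xs) = cong (x ∷_) (take-+ m n xs)

drop-++ : ∀ {A : Set} (xs ys : List A) → drop (length xs) (xs ++ ys) ≡ ys
drop-++ []       ys = refl
drop-++ (x ∷ xs) ys = drop-++ xs ys

module _ (TA : ThresholdAutomaton) (S : CounterSystem TA) where
  open Semantics TA S

  -- Prefixes and suffixes of infinite schedules.

  prefix-cong : ∀ k {π π′ : Schedule∞} → π ≗ π′ → prefix k π ≡ prefix k π′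
  prefix-cong zero    π≗π′ = refl
  prefix-cong (suc k) π≗π′ = cong₂ _∷_ (π≗π′ 0) (prefix-cong k (π≗π′ ∘ suc))

  prefix-+ : ∀ m n π → prefix (m + n) π ≡ prefix m π ++ prefix n (suffix m π)
  prefix-+ zero    n π = refl
  prefix-+ (suc m) n π = cong (π 0 ∷_) (prefix-+ m n (π ∘ suc))

  prefix-++∞ : ∀ τ k π → prefix (length τ + k) (τ ++∞ π) ≡ τ ++ prefix k π
  prefix-++∞ []      k π = refl
  prefix-++∞ (t ∷ τ) k π = cong (t ∷_) (prefix-++∞ τ k π)

  prefix-take : ∀ {k} τ π → k ≤ length τ → prefix k (τ ++∞ π) ≡ take k τ
  prefix-take {zero}  τ       π _       = refl
  prefix-take {suc k} (t ∷ τ) π (s≤s p) = cong (t ∷_) (prefix-take τ π p)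

  ++∞-assoc : ∀ τ ρ π → (τ ++ ρ) ++∞ π ≗ τ ++∞ ρ ++∞ π
  ++∞-assoc []      ρ π i       = refl
  ++∞-assoc (t ∷ τ) ρ π zero    = refl
  ++∞-assoc (t ∷ τ) ρ π (suc i) = ++∞-assoc τ ρ π i

  ++∞-congʳ : ∀ τ {π π′} → π ≗ π′ → τ ++∞ π ≗ τ ++∞ π′
  ++∞-congʳ []      eq i       = eq i
  ++∞-congʳ (t ∷ τ) eq zero    = refl
  ++∞-congʳ (t ∷ τ) eq (suc i) = ++∞-congʳ τ eq i

  ++∞-lookup : ∀ τ π i → (τ ++∞ π) (toℕ i) ≡ lookup τ i
  ++∞-lookup (t ∷ τ) π zero    = refl
  ++∞-lookup (t ∷ τ) π (suc i) = ++∞-lookup τ π i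

  ++∞-beyond : ∀ τ π i → (τ ++∞ π) (length τ + i) ≡ π i
  ++∞-beyond []      π i = refl
  ++∞-beyond (t ∷ τ) π i = ++∞-beyond τ π i

  -- Unrolling `ρ ^ω`.

  module _ (ρ : Schedule) .{{_ : NonZero (length ρ)}} where
    open ≡-Reasoning

    mod-toℕ : (i : Fin (length ρ)) → toℕ i mod length ρ ≡ i
    mod-toℕ i = toℕ-injective
      (trans (toℕ-fromℕ< (m%n<n (toℕ i) (length ρ))) (m<n⇒m%n≡m (toℕ<n i)))

    mod-+ : ∀ i → (length ρ + i) mod length ρ ≡ i mod length ρ
    mod-+ i = fromℕ<-cong _ _
      (trans (cong (_% length ρ) (+-comm (length ρ) i)) ([m+n]%n≡m%n i (length ρ)))
      (m%n<n (length ρ + i) (length ρ)) (m%n<n i (length ρ))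

    -- An index below `length ρ` is its own remainder; from a larger index one period drops out
    -- without changing the remainder.
    ^ω-unroll : ρ ^ω ≗ ρ ++∞ (ρ ^ω)
    ^ω-unroll i with <-≤-connex i (length ρ)
    ... | inj₁ i<|ρ| = begin
      lookup ρ (i mod length ρ)                   ≡⟨ cong (λ n → lookup ρ (n mod length ρ)) (toℕ-fromℕ< i<|ρ|) ⟨
      lookup ρ (toℕ (fromℕ< i<|ρ|) mod length ρ)  ≡⟨ cong (lookup ρ) (mod-toℕ (fromℕ< i<|ρ|)) ⟩
      lookup ρ (fromℕ< i<|ρ|)                     ≡⟨ ++∞-lookup ρ (ρ ^ω) (fromℕ< i<|ρ|) ⟨
      (ρ ++∞ (ρ ^ω)) (toℕ (fromℕ< i<|ρ|))         ≡⟨ cong (ρ ++∞ (ρ ^ω)) (toℕ-fromℕ< i<|ρ|) ⟩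
      (ρ ++∞ (ρ ^ω)) i                            ∎
    ... | inj₂ |ρ|≤i with k , refl ← m≤n⇒∃[o]m+o≡n |ρ|≤i = begin
      lookup ρ ((length ρ + k) mod length ρ)  ≡⟨ cong (lookup ρ) (mod-+ k) ⟩
      (ρ ^ω) k                                ≡⟨ ++∞-beyond ρ (ρ ^ω) k ⟨
      (ρ ++∞ (ρ ^ω)) (length ρ + k)           ∎

  -- Satisfaction along paths.

  -- Schedules are functions and are only known to agree pointwise, so satisfaction is carried over
  -- by induction on the formula instead of by `subst`.
  path-cong : ∀ ψ {σ σ′ π π′} → σ ≡ σ′ → π ≗ π′ →
              path⟨ σ , π ⟩⊨ ψ → path⟨ σ′ , π′ ⟩⊨ ψ
  path-cong (pform p) refl eq h = h
  path-cong (𝐆 ψ) {σ} refl eq h k =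
    path-cong ψ (cong (λ τ → execute τ σ) (prefix-cong k eq)) (eq ∘ (k +_)) (h k)
  path-cong (𝐅 ψ) {σ} refl eq (k , h) =
    k , path-cong ψ (cong (λ τ → execute τ σ) (prefix-cong k eq)) (eq ∘ (k +_)) h
  path-cong (φ ∧ ψ) refl eq (h , h′) = path-cong φ refl eq h , path-cong ψ refl eq h′

  propositional : ∀ {p σ π} → Propositional p → σ ⊨ p → path⟨ σ , π ⟩⊨ p
  propositional (pform _) h        = h
  propositional (P ∧ Q)   (h , h′) = propositional P h , propositional Q h′

  true-holds : ∀ {σ} → σ ⊨ true
  true-holds ℓ ℓ∈⊥ = ⊥-elim (Subset.∉⊥ ℓ∈⊥)

  -- Induction on canonical formulas.

  -- View P ψ takes a canonical ψ apart, with P known for the arguments of all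
  -- 𝐅 directly below ψ or below its 𝐆.
  data 𝐆View (P : Formula → Set) : Formula → Set where
    𝐆true : 𝐆View P true
    𝐆body : ∀ {p ψs} → Propositional p → IsCanonical (p ∧𝐅 ψs ∧𝐆 true) → All P ψs →
            𝐆View P (p ∧𝐅 ψs ∧𝐆 true)

  data View (P : Formula → Set) : Formula → Set where
    view : ∀ {p ψs χ} → Propositional p → IsCanonical (p ∧𝐅 ψs ∧𝐆 χ) → All P ψs →
           𝐆View P χ → View P (p ∧𝐅 ψs ∧𝐆 χ)

  module _ {P : Formula → Set} (step : ∀ {ψ} → View P ψ → P ψ) where
    -- Mutual recursion, with the map over `All` written out, keeps the descent into the arguments
    -- of 𝐅 visibly structural, also two levels down below a 𝐆.
    canonical-view : ∀ {r ψ} → Canonical r ψ → View P ψ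
    canonical-ind  : ∀ {r ψ} → Canonical r ψ → P ψ
    canonical-all  : ∀ {ψs} → All IsCanonical ψs → All P ψs

    canonical-view c@(rank₀ p)       = view p (_ , c) [] 𝐆true
    canonical-view c@(rank₁ p cs)    = view p (_ , c) (canonical-all cs) 𝐆true
    canonical-view c@(rank₂ p cs _ (rank₀ q)) =
      view p (_ , c) (canonical-all cs) (𝐆body q (_ , rank₀ q) [])
    canonical-view c@(rank₂ p cs _ (rank₁ q ds)) =
      view p (_ , c) (canonical-all cs) (𝐆body q (_ , rank₁ q ds) (canonical-all ds))
    -- A body of rank 2 contradicts the bound `r ≤ 1`.
    canonical-view (rank₂ _ _ (s≤s ()) (rank₂ _ _ _ _))

    canonical-ind c = step (canonical-view c)

    canonical-all []             = []
    canonical-all ((_ , c) ∷ cs) = canonical-ind c ∷ canonical-all cs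

  -- Ids and coverage in the canonical syntax tree.

  module _ (C : CanonicalForms) (φ : Formula) where
    open CanonicalForms C

    bodyOf : Formula → Formula
    bodyOf (𝐆 ψ) = ψ
    bodyOf (𝐅 ψ) = ψ
    bodyOf ψ     = ψ

    -- Conjunctions nest to the right, so the last conjunct is no `∧` and is returned whole by the
    -- final clause; the indices thus agree with the numbering of the children in the tree.
    conjunct : Formula → ℕ → Formula
    conjunct (ψ ∧ χ) zero    = ψ
    conjunct (ψ ∧ χ) (suc i) = conjunct χ i
    conjunct ψ       _       = ψ

    -- The formula is read off the id by descending through conjuncts; the
    -- start is chosen so that the id [ 0 ] leads to can φ.
    label : Id → Formula
    label = foldl (λ ψ i → conjunct (bodyOf ψ) i) (can φ ∧ true)

    label-∷ʳ : ∀ w i → label (w ∷ʳ i) ≡ conjunct (bodyOf (label w)) i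
    label-∷ʳ w i = foldl-∷ʳ _ _ i w

    -- `bodyOf (can φ)` computes only once `can φ` is exposed as a conjunction; the equation
    -- provides this.
    bodyOf-Body : ∀ {ψ χ p q} → Body C φ ψ χ → χ ≡ p ∧ q → bodyOf ψ ≡ χ
    bodyOf-Body whole  eq rewrite eq = refl
    bodyOf-Body under𝐅 _ = refl
    bodyOf-Body under𝐆 _ = refl

    conjunct-𝐅 : ∀ ψs χ i → conjunct (foldr (λ ψ ξ → 𝐅 ψ ∧ ξ) (𝐆 χ) ψs) (toℕ i) ≡ 𝐅 (lookup ψs i)
    conjunct-𝐅 (ψ ∷ ψs) χ zero    = refl
    conjunct-𝐅 (ψ ∷ ψs) χ (suc i) = conjunct-𝐅 ψs χ i

    conjunct-𝐆 : ∀ ψs χ → conjunct (foldr (λ ψ ξ → 𝐅 ψ ∧ ξ) (𝐆 χ) ψs) (length ψs) ≡ 𝐆 χ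
    conjunct-𝐆 []       χ = refl
    conjunct-𝐆 (ψ ∷ ψs) χ = conjunct-𝐆 ψs χ

    -- Makes the formula of a node a function of its id, so that no 𝐅-node shares its id with a
    -- 𝐆-node.
    label-𝓣 : ∀ {ψ w} → 𝓣 C φ ψ w → label w ≡ ψ
    label-child : ∀ {ψ w p q} → 𝓣 C φ ψ w → Body C φ ψ (p ∧ q) → ∀ i →
                  label (w ∷ʳ i) ≡ conjunct (p ∧ q) i

    label-𝓣 root = refl
    label-𝓣 (child₀ n b _) = label-child n b 0
    label-𝓣 (child𝐅 {ψs = ψs} {χ} n b _ i) =
      trans (label-child n b (suc (toℕ i))) (conjunct-𝐅 ψs χ i)
    label-𝓣 (child𝐆 {ψs = ψs} {χ} n b _) =
      trans (label-child n b (suc (length ψs))) (conjunct-𝐆 ψs χ)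

    label-child {w = w} n b i = trans (label-∷ʳ w i)
      (cong (λ ψ → conjunct ψ i) (trans (cong bodyOf (label-𝓣 n)) (bodyOf-Body b refl)))

    covered-∷ʳ : ∀ {w} i → Covered C φ w → Covered C φ (w ∷ʳ i)
    covered-∷ʳ i (u₁ , u₂ , ψ , refl , n) = u₁ , u₂ ∷ʳ i , ψ , ++-assoc u₁ u₂ [ i ] , n

    covered-𝐆 : ∀ {ψ w} i → 𝓣 C φ (𝐆 ψ) w → Covered C φ (w ∷ʳ i)
    covered-𝐆 {w = w} i n = w , [ i ] , _ , refl , n

    -- `label []` is the conjunction `can φ ∧ true`, hence no 𝐆-formula.
    uncovered-[] : ¬ Covered C φ []
    uncovered-[] ([] , [] , _ , refl , n) with () ← label-𝓣 n

    -- A 𝐆-node covering `w ∷ʳ i` either has this very id, which the labels exclude, or has a prefix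
    -- of `w` as its id and so covers `w` already.
    uncovered-∷ʳ : ∀ {ψ w i} → 𝓣 C φ ψ (w ∷ʳ i) → (∀ χ → ψ ≢ 𝐆 χ) →
                   ¬ Covered C φ w → ¬ Covered C φ (w ∷ʳ i)
    uncovered-∷ʳ {w = w} n ψ≢𝐆 ¬c (u₁ , u₂ , χ , eq , m) with initLast u₂
    ... | [] = ψ≢𝐆 χ (trans (sym (label-𝓣 n))
                 (trans (cong label (trans eq (++-identityʳ u₁))) (label-𝓣 m)))
    ... | us ∷ʳ′ x = ¬c (u₁ , us , χ , ∷ʳ-injectiveˡ w (u₁ ++ us) (trans eq (sym (++-assoc u₁ us [ x ]))) , m)

    -- Configurations along the lasso and their periodicity.

    module _ {σ : Config} (L : Lasso σ) where
      open Lasso L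

      cfg : ℕ → Config
      cfg j = execute (prefix j schedule) σ

      -- A record, so that j and ψ can be inferred.
      record At (j : ℕ) (ψ : Formula) : Set where
        constructor at
        field holds : path⟨ cfg j , suffix j schedule ⟩⊨ ψ
      open At

      execute-++ : ∀ π π′ → execute (π ++ π′) σ ≡ execute π′ (execute π σ)
      execute-++ π π′ = foldl-++ _ σ π π′

      cfg-+ : ∀ j k → cfg (j + k) ≡ execute (prefix k (suffix j schedule)) (cfg j)
      cfg-+ j k = trans (cong (λ π → execute π σ) (prefix-+ j k schedule))
                        (execute-++ (prefix j schedule) _)

      suffix-suffix : ∀ j k → suffix (j + k) schedule ≗ suffix k (suffix j schedule)
      suffix-suffix j k i = cong schedule (+-assoc j k i)

      𝐅-intro : ∀ {j k ψ} → j ≤ k → At k ψ → At j (𝐅 ψ)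
      𝐅-intro {j} {k} {ψ} j≤k (at h) with d , refl ← m≤n⇒∃[o]m+o≡n j≤k =
        at (d , path-cong ψ (cfg-+ j d) (suffix-suffix j d) h)

      𝐆-intro : ∀ {j ψ} → (∀ k → j ≤ k → At k ψ) → At j (𝐆 ψ)
      𝐆-intro {j} {ψ} h = at λ k →
        path-cong ψ (cfg-+ j k) (suffix-suffix j k) (holds (h (j + k) (m≤m+n j k)))

      𝐆-true : ∀ {j} → At j (𝐆 true)
      𝐆-true {j} = at λ k → true-holds {execute (prefix k (suffix j schedule)) (cfg j)}

      conjunction : ∀ {j p} ψs {χ} → Propositional p → cfg j ⊨ p →
                    (∀ i → At j (𝐅 (lookup ψs i))) → At j (𝐆 χ) →
                    At j (p ∧𝐅 ψs ∧𝐆 χ)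
      conjunction {j} ψs {χ} P h f g = at (propositional P h , conjuncts ψs f)
        where
        conjuncts : ∀ ψs → (∀ i → At j (𝐅 (lookup ψs i))) →
                    path⟨ cfg j , suffix j schedule ⟩⊨ foldr (λ ψ ξ → 𝐅 ψ ∧ ξ) (𝐆 χ) ψs
        conjuncts []       f = holds g
        conjuncts (ψ ∷ ψs) f = holds (f zero) , conjuncts ψs (f ∘ suc)

      -- With one copy of `ρ` unrolled, `τ ++ ρ` is an initial segment of the schedule.
      cfg-take : ∀ {j} → j ≤ length τ + length ρ → cfg j ≡ execute (take j (τ ++ ρ)) σ
      cfg-take {j} j≤ = cong (λ π → execute π σ) (begin
        prefix j schedule                  ≡⟨ prefix-cong j (++∞-congʳ τ (^ω-unroll ρ)) ⟩
        prefix j (τ ++∞ ρ ++∞ (ρ ^ω))      ≡⟨ prefix-cong j (++∞-assoc τ ρ (ρ ^ω)) ⟨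
        prefix j ((τ ++ ρ) ++∞ (ρ ^ω))     ≡⟨ prefix-take (τ ++ ρ) (ρ ^ω) (subst (j ≤_) (sym (length-++ τ)) j≤) ⟩
        take j (τ ++ ρ)                    ∎)
        where open ≡-Reasoning

      cfg-|τ| : cfg (length τ) ≡ execute τ σ
      cfg-|τ| = cong (λ π → execute π σ)
        (trans (prefix-take τ (ρ ^ω) ≤-refl) (take-all (length τ) τ ≤-refl))

      cfg-in-loop : ∀ i → cfg (length τ + i) ≡ execute (prefix i (ρ ^ω)) (execute τ σ)
      cfg-in-loop i = trans (cong (λ π → execute π σ) (prefix-++∞ τ i (ρ ^ω))) (execute-++ τ _)

      -- One round of `ρ` leads `execute τ σ` back to itself, and `ρ ^ω` follows again.
      cfg-period : ∀ {j} → length τ ≤ j → cfg (length ρ + j) ≡ cfg j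
      cfg-period {j} |τ|≤j with i , refl ← m≤n⇒∃[o]m+o≡n |τ|≤j = begin
        cfg (length ρ + (length τ + i))
          ≡⟨ cong cfg (x∙yz≈y∙xz (length ρ) (length τ) i) ⟩
        cfg (length τ + (length ρ + i))
          ≡⟨ cfg-in-loop (length ρ + i) ⟩
        execute (prefix (length ρ + i) (ρ ^ω)) σ′
          ≡⟨ cong (λ π → execute π σ′) (prefix-cong (length ρ + i) (^ω-unroll ρ)) ⟩
        execute (prefix (length ρ + i) (ρ ++∞ (ρ ^ω))) σ′
          ≡⟨ cong (λ π → execute π σ′) (prefix-++∞ ρ i (ρ ^ω)) ⟩
        execute (ρ ++ prefix i (ρ ^ω)) σ′
          ≡⟨ foldl-++ _ σ′ ρ _ ⟩
        execute (prefix i (ρ ^ω)) (execute ρ σ′)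
          ≡⟨ cong (execute (prefix i (ρ ^ω))) once ⟩
        execute (prefix i (ρ ^ω)) σ′
          ≡⟨ cfg-in-loop i ⟨
        cfg (length τ + i) ∎
        where
        open ≡-Reasoning
        σ′ = execute τ σ
        once : execute ρ σ′ ≡ σ′
        once = trans (cong (λ π → execute π σ′) (sym (++-identityʳ ρ))) (returns 1)

      cfg-periods : ∀ k {j} → length τ ≤ j → cfg (k * length ρ + j) ≡ cfg j
      cfg-periods zero    |τ|≤j = refl
      cfg-periods (suc k) {j} |τ|≤j =
        trans (cong cfg (+-assoc (length ρ) (k * length ρ) j))
          (trans (cfg-period (≤-trans |τ|≤j (m≤n+m j (k * length ρ)))) (cfg-periods k |τ|≤j))

      -- A position `length τ + i` folds back to `length τ + i % length ρ`, inside the first round.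
      -- As `j ≤ length τ`, folding never falls below `j`.
      forever : ∀ {j} (Q : Config → Set) → j ≤ length τ →
                (∀ k → j ≤ k → k ≤ length τ + length ρ → Q (cfg k)) →
                ∀ k → j ≤ k → Q (cfg k)
      forever {j} Q j≤|τ| h k j≤k with ≤-total k (length τ)
      ... | inj₁ k≤|τ| = h k j≤k (≤-trans k≤|τ| (m≤m+n _ _))
      ... | inj₂ |τ|≤k with i , refl ← m≤n⇒∃[o]m+o≡n |τ|≤k = subst Q (sym folded)
              (h (length τ + i % length ρ) (≤-trans j≤|τ| (m≤m+n _ _))
                 (+-monoʳ-≤ (length τ) (m%n≤n i (length ρ))))
        where
        open ≡-Reasoning
        folded : cfg (length τ + i) ≡ cfg (length τ + i % length ρ)
        folded = begin
          cfg (length τ + i)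
            ≡⟨ cong (λ n → cfg (length τ + n)) (m≡m%n+[m/n]*n i (length ρ)) ⟩
          cfg (length τ + (i % length ρ + i / length ρ * length ρ))
            ≡⟨ cong cfg (trans (sym (+-assoc (length τ) _ _)) (+-comm _ (i / length ρ * length ρ))) ⟩
          cfg (i / length ρ * length ρ + (length τ + i % length ρ))
            ≡⟨ cfg-periods (i / length ρ) (m≤m+n _ _) ⟩
          cfg (length τ + i % length ρ) ∎

      -- Each position between `j` and the end of the first round is reached by a prefix of what
      -- `τ ++ ρ` leaves after `j`.
      forever-Cfgs : ∀ {j} ψ → j ≤ length τ →
                     Cfgs⟨ cfg j , drop j (τ ++ ρ) ⟩⊨ ψ → ∀ k → j ≤ k → cfg k ⊨ ψ
      forever-Cfgs {j} ψ j≤|τ| h = forever (_⊨ ψ) j≤|τ| reached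
        where
        open ≡-Reasoning
        reached : ∀ k → j ≤ k → k ≤ length τ + length ρ → cfg k ⊨ ψ
        reached k j≤k k≤ with i , refl ← m≤n⇒∃[o]m+o≡n j≤k = subst (_⊨ ψ) (sym split)
            (h (take i π) (drop i π) (sym (take++drop≡id i π)))
          where
          π = drop j (τ ++ ρ)
          split : cfg (j + i) ≡ execute (take i π) (cfg j)
          split = begin
            cfg (j + i)                                        ≡⟨ cfg-take k≤ ⟩
            execute (take (j + i) (τ ++ ρ)) σ                   ≡⟨ cong (λ π → execute π σ) (take-+ j i (τ ++ ρ)) ⟩
            execute (take j (τ ++ ρ) ++ take i π) σ             ≡⟨ execute-++ (take j (τ ++ ρ)) _ ⟩
            execute (take i π) (execute (take j (τ ++ ρ)) σ)    ≡⟨ cong (execute (take i π)) (cfg-take (≤-trans (m≤m+n j i) k≤)) ⟨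
            execute (take i π) (cfg j)                         ∎

      -- From the witness conditions to satisfaction.

      module _ {𝒢 : CutGraph C φ} (cut : CutFunction C φ L 𝒢) (W : IsWitness C φ L cut) where
        open CutGraph 𝒢
        open CutFunction cut
        open IsWitness W

        position : ∀ {ψ w} → 𝓣 C φ (𝐅 ψ) w → ℕ
        position n = toℕ (ζ (vertex C φ n))

        position-cuts : ∀ {ψ w} (n : 𝓣 C φ (𝐅 ψ) w) →
          Cuts (position n) (τ ++ ρ) (take (position n) (τ ++ ρ)) (drop (position n) (τ ++ ρ))
        position-cuts n = sym (take++drop≡id (position n) (τ ++ ρ)) ,
          trans (length-take (position n) (τ ++ ρ))
            (m≤n⇒m⊓n≡m (subst (position n ≤_) (sym (length-++ τ)) (<⇒≤ (toℕ<n (ζ (vertex C φ n))))))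

        cfg-position : ∀ {ψ w} (n : 𝓣 C φ (𝐅 ψ) w) →
                       cfg (position n) ≡ execute (take (position n) (τ ++ ρ)) σ
        cfg-position n = cfg-take (<⇒≤ (toℕ<n (ζ (vertex C φ n))))

        -- Merges `C2` and `C3`: the invariant starts at the cut if that lies before the loop, and
        -- at the loop start otherwise, hence the minimum.
        local : ∀ {p ψs χ w} (n : 𝓣 C φ (𝐅 (p ∧𝐅 ψs ∧𝐆 χ)) w) →
                cfg (position n) ⊨ p ×
                (∀ k → position n ⊓ length τ ≤ k → cfg k ⊨ prop χ)
        local {p} {ψs} {χ} n with <-≤-connex (position n) (length τ)
        ... | inj₁ <|τ| with now , later ← C2 {p} {ψs} {χ} n <|τ| (take (position n) (τ ++ ρ)) _ (position-cuts n) =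
              subst (_⊨ p) (sym (cfg-position n)) now ,
              λ k ≤k → forever-Cfgs (prop χ) (<⇒≤ <|τ|)
                (subst (λ c → Cfgs⟨ c , drop (position n) (τ ++ ρ) ⟩⊨ prop χ) (sym (cfg-position n)) later)
                k (subst (_≤ k) (m≤n⇒m⊓n≡m (<⇒≤ <|τ|)) ≤k)
        ... | inj₂ |τ|≤ with now , later ← C3 {p} {ψs} {χ} n |τ|≤ (take (position n) (τ ++ ρ)) _ (position-cuts n) =
              subst (_⊨ p) (sym (cfg-position n)) now ,
              λ k ≤k → forever-Cfgs (prop χ) ≤-refl
                (subst (λ (c , π) → Cfgs⟨ c , π ⟩⊨ prop χ)
                  (cong₂ _,_ (sym cfg-|τ|) (sym (drop-++ τ ρ))) later)
                k (subst (_≤ k) (m≥n⇒m⊓n≡n |τ|≤) ≤k)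

        position-covered : ∀ {ψ w} (n : 𝓣 C φ (𝐅 ψ) w) → Covered C φ w → length τ ≤ position n
        position-covered n c = subst (_≤ position n) start (order (proj₁ (edges-b n c)))

        Recurring : Formula → Set
        Recurring ψ = ∀ j → ∃[ k ] (j ≤ k × At k ψ)

        -- Two implications serve where deciding `Covered` would be needed otherwise; each status
        -- passes from a node to its 𝐅-children.
        Sound : Formula → Set
        Sound ψ = ∀ {w} (n : 𝓣 C φ (𝐅 ψ) w) →
                  (Covered C φ w → Recurring ψ) × (¬ Covered C φ w → At (position n) ψ)

        recurring⇒𝐅 : ∀ {ψ j} → Recurring ψ → At j (𝐅 ψ)
        recurring⇒𝐅 {j = j} r with k , j≤k , h ← r j = 𝐅-intro j≤k h

        lookup-Sound : ∀ {ψs} → All Sound ψs → ∀ i → Sound (lookup ψs i)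
        lookup-Sound (s ∷ ss) zero    = s
        lookup-Sound (s ∷ ss) (suc i) = lookup-Sound ss i

        invariant : ∀ {χ w j} → 𝐆View Sound χ → 𝓣 C φ (𝐆 χ) w →
                    (∀ k → j ≤ k → cfg k ⊨ prop χ) → At j (𝐆 χ)
        invariant 𝐆true n h = 𝐆-true
        invariant {j = j} (𝐆body {p} {ψs} P c Ss) n h = 𝐆-intro λ k j≤k →
          conjunction ψs P (h k j≤k)
            -- The children lie below the 𝐆-node `n`, so they are covered and recur, and their 𝐅
            -- holds at every `k`.
            (λ i → recurring⇒𝐅 (proj₁ (lookup-Sound Ss i (child𝐅 {ψs = ψs} n under𝐆 c i)) (covered-𝐆 _ n)))
            𝐆-true

        sound : ∀ {ψ} → View Sound ψ → Sound ψ
        sound (view {p} {ψs} {χ} P c Ss V) {w} n = recur , attain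
          where
          child : ∀ i → 𝓣 C φ (𝐅 (lookup ψs i)) (w ∷ʳ suc (toℕ i))
          child = child𝐅 {ψs = ψs} n under𝐅 c

          recur : Covered C φ w → Recurring (p ∧𝐅 ψs ∧𝐆 χ)
          recur cov j = k , j≤k , conjunction ψs P
              (subst (_⊨ p) (sym (cfg-periods j |τ|≤)) (proj₁ (local {p} {ψs} {χ} n)))
              (λ i → recurring⇒𝐅 (proj₁ (lookup-Sound Ss i (child i)) (covered-∷ʳ _ cov)))
              (invariant V (child𝐆 {ψs = ψs} n under𝐅 c)
                (λ l k≤l → proj₂ (local {p} {ψs} {χ} n) l
                  (≤-trans (m⊓n≤m _ _) (≤-trans (m≤n+m _ (j * length ρ)) k≤l))))
            where
            -- A round has at least one transition, so `j` rounds after the cut the position is at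
            -- least `j`, with the same configuration as at the cut.
            k     = j * length ρ + position n
            |τ|≤  = position-covered n cov
            j≤k   : j ≤ k
            j≤k   = ≤-trans (m≤m*n j (length ρ)) (m≤m+n _ (position n))

          attain : ¬ Covered C φ w → At (position n) (p ∧𝐅 ψs ∧𝐆 χ)
          attain unc = conjunction ψs P (proj₁ (local {p} {ψs} {χ} n))
              (λ i → 𝐅-intro (order (edges-c n (child i) unc (unc′ i)))
                       (proj₂ (lookup-Sound Ss i (child i)) (unc′ i)))
              (invariant V (child𝐆 {ψs = ψs} n under𝐅 c)
                (λ l ≤l → proj₂ (local {p} {ψs} {χ} n) l (≤-trans (m⊓n≤m _ _) ≤l)))
            where
            unc′ : ∀ i → ¬ Covered C φ (w ∷ʳ suc (toℕ i))
            unc′ i = uncovered-∷ʳ (child i) (λ _ ()) unc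

        -- A separate `ψ` lets the view be matched, which the opaque index `can φ` would block. The
        -- root has no cut position; position 0 precedes the cuts of all its children.
        root-sound : ∀ {ψ} → View Sound ψ → can φ ≡ ψ → At 0 (can φ)
        root-sound (view {p} {ψs} {χ} P c Ss V) eq = subst (At 0) (sym eq)
          (conjunction ψs P (proj₁ (C1 {p} {ψs} {χ} eq))
            (λ i → 𝐅-intro z≤n (proj₂ (lookup-Sound Ss i (child i))
                     -- The root id `[ 0 ]` extends `[]`, which is uncovered, and `can φ` is a
                     -- conjunction, so the root is no 𝐆-node.
                     (uncovered-∷ʳ (child i) (λ _ ()) (uncovered-∷ʳ root root≢𝐆 uncovered-[]))))
            (invariant V (child𝐆 {ψs = ψs} root b c)
              (forever-Cfgs (prop χ) z≤n (proj₂ (C1 {p} {ψs} {χ} eq)))))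
          where
          b : Body C φ (can φ) (p ∧𝐅 ψs ∧𝐆 χ)
          b = subst (Body C φ (can φ)) eq whole
          child : ∀ i → 𝓣 C φ (𝐅 (lookup ψs i)) ([ 0 ] ∷ʳ suc (toℕ i))
          child = child𝐅 {ψs = ψs} root b c
          root≢𝐆 : ∀ ξ → can φ ≢ 𝐆 ξ
          root≢𝐆 ξ eq′ with () ← trans (sym eq) eq′

        satisfied : path⟨ σ , schedule ⟩⊨ φ
        satisfied = Equivalence.from (equivalent φ σ schedule applicable) (holds
          (root-sound (canonical-view sound (proj₂ (canonical φ))) refl))

theorem4p12 : (TA : ThresholdAutomaton) (S : CounterSystem TA) →
    let open Semantics TA S in
    (C : CanonicalForms) (σ : Config) (L : Lasso σ) (φ : Formula) →
    HasWitness C φ L →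
    path⟨ σ , Lasso.schedule L ⟩⊨ φ
theorem4p12 TA S C σ L φ (_ , cut , W) = satisfied TA S C φ L cut W
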